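{- Let $n\ge 2$, let $TT_n$ be the transitive tournament on $n$ vertices, and let $\alpha=(\alpha_1,\dots,\alpha_s)\in\mathbb{K}_s$ with $\sum_{i=1}^s|\alpha_i|=n-1$. Then the number $f_{TT_n}(\alpha)$ of oriented (Hamiltonian) paths of type $P(\alpha)$ in $TT_n$ equals $\mathcal{F}(\alpha)$ if $\alpha$ is non-symmetric, and equals $\frac{1}{2}\mathcal{F}(\alpha)$ if $\alpha$ is symmetric.
   Context: A tournament is an orientation of a complete graph. The transitive tournament $TT_n$ has vertices $v_1,\dots,v_n$ and arcs $(v_i,v_j)$ for all $i<j$. For $s\ge1$, $\mathbb{K}_s=\{(\alpha_1,\dots,\alpha_s)\in\mathbb{Z}^s:\ \alpha_i\alpha_{i+1}<0 \text{ for all } 1\le i\le s-1\}$ (in particular, when $s\ge 2$ all entries are nonzero and signs alternate; we take all entries nonzero). An oriented path is a digraph whose underlying graph is a path; a block is a maximal directed subpath. An oriented path $P$ is of type $P(\alpha_1,\dots,\alpha_s)$ if $P$ is the concatenation of $s$ blocks $I_1,\dots,I_s$, where $I_i$ has ends $x_i,y_i$, $I_i\cap I_{i+1}=\{y_i\}=\{x_{i+1}\}$, $I_i$ has length $|\alpha_i|$, and $\alpha_i>0$ iff $I_i$ is directed from $x_i$ to $y_i$. $f_T(\alpha)$ denotes the number of (distinct, i.e. with distinct arc sets) oriented paths of type $P(\alpha)$ in $T$. For $\alpha=(\alpha_1,\dots,\alpha_s)$, write $-\alpha=(-\alpha_1,\dots,-\alpha_s)$ and $\overline{\alpha}=(\alpha_s,\dots,\alpha_1)$;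 $\alpha$ is symmetric if $\alpha=-\overline{\alpha}$. The path-function $\mathcal{F}$ on tuples in $\bigcup_{s\ge1}\mathbb{K}_s$ (with nonzero entries) is defined recursively: $\mathcal{F}(\alpha_1)=1$ for every nonzero integer $\alpha_1$; for $s\ge2$, $\mathcal{F}(\alpha_1,\dots,\alpha_s)=\sum_{i=1}^s\mathcal{F}(\alpha_1,\dots,\alpha_{i-1},\alpha_i*1,\alpha_{i+1},\dots,\alpha_s)$, where $\alpha_i*1=\alpha_i-1$ if $\alpha_i>0$ and $\alpha_i*1=\alpha_i+1$ if $\alpha_i<0$, and where a tuple containing a zero entry is reduced by the rules $\mathcal{F}(0,\alpha_2,\dots,\alpha_t)=\mathcal{F}(\alpha_2,\dots,\alpha_t)$, $\mathcal{F}(\alpha_1,\dots,\alpha_{t},0)=\mathcal{F}(\alpha_1,\dots,\alpha_{t})$, and $\mathcal{F}(\alpha_1,\dots,\alpha_r,0,\alpha_{r+2},\dots,\alpha_s)=\mathcal{F}(\alpha_1,\dots,\alpha_{r-1},\alpha_r+\alpha_{r+2},\alpha_{r+3},\dots,\alpha_s)$ (here $\alpha_r,\alpha_{r+2}$ have the same sign). -}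

module Defs where

open import Data.Empty using (⊥-elim)
open import Data.Fin.Base as Fin using (Fin; zero; suc)
import Data.Fin.Properties as Fin
open import Data.Integer.Base as ℤ using (ℤ; +_; +0; +[1+_]; -[1+_]; ∣_∣; 0ℤ)
open import Data.List.Base using (List; []; _∷_; _++_; map; length; reverse; tabulate; _[_]%=_)
open import Data.List.Properties using (tabulate-cong)
open import Data.List.Relation.Binary.BagAndSetEquality using ([_]-Equality; set)
open import Data.List.Relation.Unary.All using (All; []; _∷_)
open import Data.List.Relation.Unary.Linked using (Linked; []; [-]; _∷_)
open import Data.List.Relation.Unary.Unique.Propositional using (Unique)
open import Data.Nat.Base as ℕ using (ℕ; zero; suc; _+_; _≤_; s≤s)
open import Data.Nat.ListAction using (sum)
import Data.Nat.Properties as ℕ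
open import Data.Product.Base using (_×_; _,_; swap)
open import Data.Sum.Base using (_⊎_; inj₁; inj₂)
open import Function.Base using (flip)
open import Function.Bundles using (Bijection)
open import Level using (0ℓ)
open import Relation.Binary.Bundles using (Setoid)
open import Relation.Binary.Core using (Rel)
open import Relation.Binary.Definitions using (Asymmetric; tri<; tri≈; tri>)
import Relation.Binary.Construct.On as On
open import Relation.Binary.PropositionalEquality using (_≡_; _≢_; refl; sym; trans; cong; setoid)

------------------------------------------------------------------------
-- Tuples

record 𝕂 (s : ℕ) (α : List ℤ) : Set where
  field
    length≡s    : length α ≡ s
    nonzero     : All (_≢ 0ℤ) α
    alternating : Linked (λ a b → a ℤ.* b ℤ.< 0ℤ) α

‖_‖ : List ℤ → ℕ
‖ α ‖ = sum (map ∣_∣ α)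

Symmetric : List ℤ → Set
Symmetric α = α ≡ map ℤ.-_ (reverse α)

------------------------------------------------------------------------
-- Tournaments

record Tournament (n : ℕ) : Set₁ where
  field
    _⟶_   : Rel (Fin n) 0ℓ
    asym  : Asymmetric _⟶_
    total : ∀ {u v} → u ≢ v → (u ⟶ v) ⊎ (v ⟶ u)

TT : (n : ℕ) → Tournament n
TT n = record { _⟶_ = Fin._<_ ; asym = Fin.<-asym ; total = total }
  where
  total : ∀ {u v : Fin n} → u ≢ v → (u Fin.< v) ⊎ (v Fin.< u)
  total {u} {v} u≢v with Fin.<-cmp u v
  ... | tri< u<v _ _ = inj₁ u<v
  ... | tri≈ _ u≡v _ = ⊥-elim (u≢v u≡v)
  ... | tri> _ _ v<u = inj₂ v<u

------------------------------------------------------------------------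
-- Oriented paths

module _ {V : Set} where

  data Walk (R : Rel V 0ℓ) : ℕ → V → V → Set where
    stop : ∀ {x} → Walk R 0 x x
    step : ∀ {k x y z} → R x y → Walk R k y z → Walk R (suc k) x z

  -- All vertices except the initial one.
  later : ∀ {R k x y} → Walk R k x y → List V
  later stop                 = []
  later (step {y = y} _ w) = y ∷ later w

  steps : ∀ {R k x y} → Walk R k x y → List (V × V)
  steps stop                         = []
  steps (step {x = x} {y = y} _ w) = (x , y) ∷ steps w

module _ {n : ℕ} (T : Tournament n) where
  open Tournament T

  private
    V = Fin n

  -- A block with ends x, y, listed from x to y: directed from x to y if
  -- the entry is positive, and from y to x (so that each step from x
  -- towards y goes against an arc) if it is negative.
  Block : ℤ → V → V → Set
  Block (+ k)    x y = Walk _⟶_ k x y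
  Block -[1+ k ] x y = Walk (flip _⟶_) (suc k) x y

  blockLater : ∀ a {x y} → Block a x y → List V
  blockLater (+ _)    w = later w
  blockLater -[1+ _ ] w = later w

  blockArcs : ∀ a {x y} → Block a x y → List (V × V)
  blockArcs (+ _)    w = steps w
  blockArcs -[1+ _ ] w = map swap (steps w)

  data Blocks : List ℤ → V → V → Set where
    []  : ∀ {x} → Blocks [] x x
    _∷_ : ∀ {a α x y z} → Block a x y → Blocks α y z → Blocks (a ∷ α) x z

  blocksLater : ∀ {α x y} → Blocks α x y → List V
  blocksLater []                  = []
  blocksLater (_∷_ {a = a} I Is) = blockLater a I ++ blocksLater Is

  blocksArcs : ∀ {α x y} → Blocks α x y → List (V × V)
  blocksArcs []                  = []
  blocksArcs (_∷_ {a = a} I Is) = blockArcs a I ++ blocksArcs Is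

  -- An oriented path in T presented as of type P(α). For α in 𝕂 the
  -- alternation of signs makes the blocks maximal directed subpaths, and
  -- `distinct` makes consecutive blocks meet in their common end only.
  record OrientedPath (α : List ℤ) : Set where
    field
      {origin terminus} : V
      blocks            : Blocks α origin terminus
      distinct          : Unique (origin ∷ blocksLater blocks)

    arcs : List (V × V)
    arcs = blocksArcs blocks

  -- Presentations with the same set of arcs are the same oriented path; in
  -- particular the two traversals of a path are identified when both
  -- present it as of type P(α).
  OrientedPaths : List ℤ → Setoid 0ℓ 0ℓ
  OrientedPaths α = On.setoid ([ set ]-Equality (V × V)) (OrientedPath.arcs {α})

  -- f_T(α) = k
  f[_]_≐_ : List ℤ → ℕ → Set
  f[_]_≐_ α k = Bijection (setoid (Fin k)) (OrientedPaths α)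

------------------------------------------------------------------------
-- The path-function

_*1 : ℤ → ℤ
+0       *1 = +0
+[1+ k ] *1 = + k
-[1+ k ] *1 = ℤ.- (+ k)

contract : List ℤ → List ℤ
contract []               = []
contract (a ∷ +0 ∷ [])    = a ∷ []
contract (a ∷ +0 ∷ b ∷ α) = (a ℤ.+ b) ∷ α
contract (a ∷ α)          = a ∷ contract α

-- The three reduction rules for a tuple with a zero entry; a tuple without
-- zero entries is unchanged.
reduce : List ℤ → List ℤ
reduce (+0 ∷ α) = α
reduce α        = contract α

-- The recursion lowers ‖_‖ by exactly one on 𝕂, so ‖ α ‖ is enough fuel and
-- the clauses returning 0 are not reached; see 𝓕-single and 𝓕-recursion.
𝓕-fuel : ℕ → List ℤ → ℕ
𝓕-fuel _       []              = 0
𝓕-fuel _       (_ ∷ [])        = 1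
𝓕-fuel zero    (_ ∷ _ ∷ _)     = 0
𝓕-fuel (suc k) α@(_ ∷ _ ∷ _) =
  sum (tabulate λ (i : Fin (length α)) → 𝓕-fuel k (reduce (α [ i ]%= _*1)))

𝓕 : List ℤ → ℕ
𝓕 α = 𝓕-fuel ‖ α ‖ α

private
  contract-nonzero : ∀ {α} → All (_≢ 0ℤ) α → contract α ≡ α
  contract-nonzero []                              = refl
  contract-nonzero (_ ∷ [])                        = refl
  contract-nonzero {_ ∷ +0 ∷ _}       (_ ∷ q ∷ _)  = ⊥-elim (q refl)
  contract-nonzero {a ∷ +[1+ _ ] ∷ _} (_ ∷ q ∷ qs) = cong (a ∷_) (contract-nonzero (q ∷ qs))
  contract-nonzero {a ∷ -[1+ _ ] ∷ _} (_ ∷ q ∷ qs) = cong (a ∷_) (contract-nonzero (q ∷ qs))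

  ∣+∣ : ∀ a c b → a ℤ.* c ℤ.< 0ℤ → c ℤ.* b ℤ.< 0ℤ → ∣ a ℤ.+ b ∣ ≡ ∣ a ∣ + ∣ b ∣
  ∣+∣ (+ _)    _        (+ _)    _ _ = refl
  ∣+∣ -[1+ m ] _        -[1+ k ] _ _ = cong suc (sym (ℕ.+-suc m k))
  ∣+∣ +0       +[1+ _ ] -[1+ _ ] (ℤ.+<+ ()) _
  ∣+∣ +0       +0       -[1+ _ ] (ℤ.+<+ ()) _
  ∣+∣ +0       -[1+ _ ] -[1+ _ ] (ℤ.+<+ ()) _
  ∣+∣ +[1+ _ ] +[1+ _ ] -[1+ _ ] (ℤ.+<+ ()) _
  ∣+∣ +[1+ _ ] +0       -[1+ _ ] _ (ℤ.+<+ ())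
  ∣+∣ +[1+ _ ] -[1+ _ ] -[1+ _ ] _ (ℤ.+<+ ())
  ∣+∣ -[1+ _ ] +[1+ m ] +0       _ q rewrite ℕ.*-zeroʳ m with ℤ.+<+ () ← q
  ∣+∣ -[1+ _ ] +[1+ _ ] +[1+ _ ] _ (ℤ.+<+ ())
  ∣+∣ -[1+ _ ] +0       (+ _)    _ (ℤ.+<+ ())
  ∣+∣ -[1+ _ ] -[1+ _ ] (+ _)    (ℤ.+<+ ()) _

  shift : ∀ m k → suc (m + k) ≡ m + suc k
  shift m k = sym (ℕ.+-suc m k)

  ‖contract‖ : ∀ a α → All (_≢ 0ℤ) (a ∷ α) → Linked (λ a b → a ℤ.* b ℤ.< 0ℤ) (a ∷ α) →
               (i : Fin (length α)) → suc ‖ contract (a ∷ (α [ i ]%= _*1)) ‖ ≡ ‖ a ∷ α ‖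
  ‖contract‖ a (+0 ∷ _) (_ ∷ q ∷ _) _ zero = ⊥-elim (q refl)
  ‖contract‖ a (+[1+ 0 ] ∷ [])    _ _ zero = shift ∣ a ∣ 0
  ‖contract‖ a (-[1+ 0 ] ∷ [])    _ _ zero = shift ∣ a ∣ 0
  ‖contract‖ a (+[1+ 0 ] ∷ b ∷ α) _ (l₁ ∷ l₂ ∷ _) zero
    rewrite ∣+∣ a +[1+ 0 ] b l₁ l₂ | ℕ.+-assoc ∣ a ∣ ∣ b ∣ ‖ α ‖ = shift ∣ a ∣ (∣ b ∣ + ‖ α ‖)
  ‖contract‖ a (-[1+ 0 ] ∷ b ∷ α) _ (l₁ ∷ l₂ ∷ _) zero
    rewrite ∣+∣ a -[1+ 0 ] b l₁ l₂ | ℕ.+-assoc ∣ a ∣ ∣ b ∣ ‖ α ‖ = shift ∣ a ∣ (∣ b ∣ + ‖ α ‖)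
  ‖contract‖ a (+[1+ suc k ] ∷ α) (_ ∷ _ ∷ qs) _ zero
    rewrite contract-nonzero {+[1+ k ] ∷ α} ((λ ()) ∷ qs) = shift ∣ a ∣ _
  ‖contract‖ a (-[1+ suc k ] ∷ α) (_ ∷ _ ∷ qs) _ zero
    rewrite contract-nonzero { -[1+ k ] ∷ α} ((λ ()) ∷ qs) = shift ∣ a ∣ _
  ‖contract‖ a (+0 ∷ _) (_ ∷ q ∷ _) _ (suc _) = ⊥-elim (q refl)
  ‖contract‖ a (c@(+[1+ _ ]) ∷ α) (_ ∷ qs) (_ ∷ ls) (suc i) =
    trans (shift ∣ a ∣ _) (cong (λ m → ∣ a ∣ + m) (‖contract‖ c α qs ls i))
  ‖contract‖ a (c@(-[1+ _ ]) ∷ α) (_ ∷ qs) (_ ∷ ls) (suc i) =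
    trans (shift ∣ a ∣ _) (cong (λ m → ∣ a ∣ + m) (‖contract‖ c α qs ls i))

  ‖reduce‖ : ∀ α → All (_≢ 0ℤ) α → Linked (λ a b → a ℤ.* b ℤ.< 0ℤ) α →
             (i : Fin (length α)) → suc ‖ reduce (α [ i ]%= _*1) ‖ ≡ ‖ α ‖
  ‖reduce‖ (+0 ∷ _) (q ∷ _) _ _ = ⊥-elim (q refl)
  ‖reduce‖ (+[1+ 0 ] ∷ _) _ _ zero = refl
  ‖reduce‖ (-[1+ 0 ] ∷ _) _ _ zero = refl
  ‖reduce‖ (+[1+ suc k ] ∷ α) (_ ∷ qs) _ zero
    rewrite contract-nonzero {+[1+ k ] ∷ α} ((λ ()) ∷ qs) = refl
  ‖reduce‖ (-[1+ suc k ] ∷ α) (_ ∷ qs) _ zero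
    rewrite contract-nonzero { -[1+ k ] ∷ α} ((λ ()) ∷ qs) = refl
  ‖reduce‖ (a@(+[1+ _ ]) ∷ α) qs ls (suc i) = ‖contract‖ a α qs ls i
  ‖reduce‖ (a@(-[1+ _ ]) ∷ α) qs ls (suc i) = ‖contract‖ a α qs ls i

𝓕-single : ∀ a → 𝓕 (a ∷ []) ≡ 1
𝓕-single a = refl

𝓕-recursion : ∀ {s α} → 𝕂 s α → 2 ≤ s →
              𝓕 α ≡ sum (tabulate λ (i : Fin (length α)) → 𝓕 (reduce (α [ i ]%= _*1)))
𝓕-recursion {α = []}    record { length≡s = refl } ()
𝓕-recursion {α = _ ∷ []} record { length≡s = refl } (s≤s ())
𝓕-recursion {α = α@(_ ∷ _ ∷ _)} record { nonzero = qs ; alternating = ls } _ =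
  unfold ‖ α ‖ (‖reduce‖ α qs ls)
  where
  unfold : ∀ m → (∀ i → suc ‖ reduce (α [ i ]%= _*1) ‖ ≡ m) →
           𝓕-fuel m α ≡ sum (tabulate λ (i : Fin (length α)) → 𝓕 (reduce (α [ i ]%= _*1)))
  unfold zero    eq with () ← eq zero
  unfold (suc m) eq = cong sum (tabulate-cong λ i →
    cong (λ k → 𝓕-fuel k (reduce (α [ i ]%= _*1))) (sym (ℕ.suc-injective (eq i))))

{-# OPTIONS --safe #-}
module Submission where

-- A presented Hamiltonian path of TT n is a permutation of the vertices whose sequence of ascents
-- and descents is the word of α. Its maximum sits at a peak of the word: at an end, or between an
-- ascending and a descending block. Deleting the maximum shortens by one letter either of the
-- blocks meeting there, and since every block of a word with at least two blocks ends in exactly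
-- one peak, the number of permutations satisfies the recursion of 𝓕. Finally, a path is determined
-- by its edges up to the direction of traversal, and both directions are of type α exactly when α
-- is symmetric; each path is then counted twice.

open import Data.Bool.Base using (Bool; true; false; not)
open import Data.Empty using (⊥-elim)
open import Data.Fin.Base as Fin using (Fin; zero; suc; toℕ; fromℕ<)
import Data.Fin.Properties as Fin
open import Data.Integer.Base as ℤ using (ℤ; +_; +0; +[1+_]; -[1+_]; ∣_∣; 0ℤ)
import Data.Integer.Properties as ℤ
open import Data.List.Base using (List; []; _∷_; _∷ʳ_; _++_; map; concatMap; filter; length; lookup; replicate; reverse; tabulate; _ʳ++_; _[_]%=_)
open import Data.List.Membership.Propositional using (_∈_; find; lose)
open import Data.List.Membership.Propositional.Properties using (∈-++⁺ˡ; ∈-++⁺ʳ; ∈-++⁻; ∈-map⁺; ∈-map⁻; ∈-concatMap⁺; ∈-concatMap⁻; ∈-lookup; ∈-filter⁺; ∈-filter⁻)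
open import Data.List.Membership.Propositional.Properties.WithK using (unique∧set⇒bag)
open import Data.List.Properties
open import Data.List.Relation.Binary.BagAndSetEquality using (∼bag⇒↭)
open import Data.List.Relation.Binary.Permutation.Propositional using (_↭_; ↭-refl; ↭-sym; ↭-trans; prep; swap; ↭⇒↭ₛ)
open import Data.List.Relation.Binary.Permutation.Propositional.Properties using (All-resp-↭; ∈-resp-↭; ↭-length; ↭-reverse)
import Data.List.Relation.Binary.Permutation.Setoid.Properties as Permutationₛ
open import Data.List.Relation.Unary.All as All using (All; []; _∷_)
import Data.List.Relation.Unary.All.Properties as All
open import Data.List.Relation.Unary.AllPairs using ([]; _∷_)
open import Data.List.Relation.Unary.Any as Any using (here; there)
import Data.List.Relation.Unary.Any.Properties as Any
open import Data.List.Relation.Unary.Linked using (Linked; []; [-]; _∷_)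
open import Data.List.Relation.Unary.Unique.Propositional using (Unique)
import Data.List.Relation.Unary.Unique.Propositional.Properties as Unique
open import Data.Nat.Base as ℕ using (ℕ; zero; suc; _+_; _*_; _∸_; _≤_; _<_; s≤s; z≤n)
open import Data.Nat.ListAction using (sum)
import Data.Nat.Properties as ℕ
import Data.List.Membership.DecPropositional ℕ._≟_ as DecMembership
open import Data.Product using (Σ-syntax; _×_; _,_; ∃-syntax; proj₁; proj₂; map₁) renaming (swap to ×-swap)
open import Data.Sum.Base as Sum using (_⊎_; inj₁; inj₂)
open import Function.Base using (_∘_)
open import Function.Bundles using (mk⇔; Equivalence)
open import Level using (0ℓ)
open import Relation.Binary.Bundles using (Setoid)
open import Relation.Binary.Core using (Rel)
open import Relation.Binary.Definitions using (tri<; tri≈; tri>)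
open import Relation.Binary.PropositionalEquality
open import Relation.Nullary using (¬_; Dec; yes; no)
open import Defs

-- Unique lists

Unique-resp-↭ : ∀ {A : Set} {xs ys : List A} → xs ↭ ys → Unique xs → Unique ys
Unique-resp-↭ {A} xs↭ys =
  Permutationₛ.AllPairs-resp-↭ (setoid A) ≢-sym (resp₂ _≢_) (↭⇒↭ₛ xs↭ys)

lookup-injective : ∀ {A : Set} {xs : List A} → Unique xs →
                   ∀ i j → lookup xs i ≡ lookup xs j → i ≡ j
lookup-injective (_ ∷ _)  zero    zero    _  = refl
lookup-injective (x∉ ∷ _) zero    (suc j) eq = ⊥-elim (All.lookup x∉ (∈-lookup j) eq)
lookup-injective (x∉ ∷ _) (suc i) zero    eq = ⊥-elim (All.lookup x∉ (∈-lookup i) (sym eq))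
lookup-injective (_ ∷ u)  (suc i) (suc j) eq = cong suc (lookup-injective u i j eq)

-- Pigeonhole principle. It is what forces the largest value to occur in a permutation.
unique-bounded⇒length≤ : ∀ {m xs} → Unique xs → All (_< m) xs → length xs ≤ m
unique-bounded⇒length≤ {m} {xs} u b = Fin.injective⇒≤ {f = f} f-injective
  where
  f : Fin (length xs) → Fin m
  f i = fromℕ< (All.lookup b (∈-lookup i))
  f-injective : ∀ {i j} → f i ≡ f j → i ≡ j
  f-injective {i} {j} eq = lookup-injective u i j (Fin.fromℕ<-injective _ _ _ _ eq)

-- Injectivity is asked only on members of the list, because inserting a maximum is injective only
-- on sequences that stay below it.
map-unique : ∀ {A B : Set} (f : A → B) {xs} → Unique xs →
             (∀ {x y} → x ∈ xs → y ∈ xs → f x ≡ f y → x ≡ y) → Unique (map f xs)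
map-unique f []      inj = []
map-unique f (x∉ ∷ u) inj =
  All.map⁺ (All.tabulate λ y∈ eq → All.lookup x∉ y∈ (inj (here refl) (there y∈) eq)) ∷
  map-unique f u λ x∈ y∈ → inj (there x∈) (there y∈)

concatMap-unique : ∀ {A B : Set} (f : A → List B) {xs} → Unique xs →
                   (∀ {x} → x ∈ xs → Unique (f x)) →
                   (∀ {x y z} → x ∈ xs → y ∈ xs → z ∈ f x → z ∈ f y → x ≡ y) →
                   Unique (concatMap f xs)
concatMap-unique f []       _ _   = []
concatMap-unique f (x∉ ∷ u) v inj = Unique.++⁺ (v (here refl))
  (concatMap-unique f u (v ∘ there) λ x∈ y∈ → inj (there x∈) (there y∈))
  λ { (z∈ , z∈′) → let y , y∈ , z∈fy = find (∈-concatMap⁻ f z∈′) in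
      All.lookup x∉ y∈ (inj (here refl) (there y∈) z∈ z∈fy) }

-- Words of up and down steps

sgn : ℤ → Bool
sgn (+ _)    = true
sgn -[1+ _ ] = false

-- A zero entry contributes no letters, and neighbouring runs of equal sign merge, so the three
-- reduction rules are invisible at the level of words.
word : List ℤ → List Bool
word []      = []
word (a ∷ α) = replicate ∣ a ∣ (sgn a) ++ word α

-- The index is the sign of the first entry, if there is one. Matching on the constructors replaces
-- arithmetic with the products of neighbours.
data Alternates : Bool → List ℤ → Set where
  []  : ∀ {c} → Alternates c []
  pos : ∀ {k α} → Alternates false α → Alternates true (+[1+ k ] ∷ α)
  neg : ∀ {k α} → Alternates true α → Alternates false (-[1+ k ] ∷ α)

𝕂⇒alternates : ∀ {α} → All (_≢ 0ℤ) α → Linked (λ a b → a ℤ.* b ℤ.< 0ℤ) α →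
               ∃[ c ] Alternates c α
𝕂⇒alternates []                     _         = true , []
𝕂⇒alternates {+0 ∷ _}       (q ∷ _) _         = ⊥-elim (q refl)
𝕂⇒alternates {+[1+ _ ] ∷ []} _      _         = true , pos []
𝕂⇒alternates { -[1+ _ ] ∷ []} _     _         = false , neg []
𝕂⇒alternates {+[1+ _ ] ∷ _ ∷ _} (_ ∷ qs) (l ∷ ls) with 𝕂⇒alternates qs ls
... | true  , pos A with ℤ.+<+ () ← l
... | false , neg A = true , pos (neg A)
𝕂⇒alternates { -[1+ _ ] ∷ _ ∷ _} (_ ∷ qs) (l ∷ ls) with 𝕂⇒alternates qs ls
... | true  , pos A = false , neg (pos A)
... | false , neg A with ℤ.+<+ () ← l

alternates⇒𝕂 : ∀ {c α} → Alternates c α → 𝕂 (length α) α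
alternates⇒𝕂 A = record { length≡s = refl ; nonzero = nonzero A ; alternating = linked A }
  where
  nonzero : ∀ {c α} → Alternates c α → All (_≢ 0ℤ) α
  nonzero []      = []
  nonzero (pos A) = (λ ()) ∷ nonzero A
  nonzero (neg A) = (λ ()) ∷ nonzero A
  linked : ∀ {c α} → Alternates c α → Linked (λ a b → a ℤ.* b ℤ.< 0ℤ) α
  linked []              = []
  linked (pos [])        = [-]
  linked (neg [])        = [-]
  linked (pos (neg A)) = ℤ.-<+ ∷ linked (neg A)
  linked (neg (pos A)) = ℤ.-<+ ∷ linked (pos A)

-- Reduction and the recursion of `𝓕`, read on words

contract-alternates : ∀ {c α} → Alternates c α → contract α ≡ α
contract-alternates []            = refl
contract-alternates (pos [])      = refl
contract-alternates (neg [])      = refl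
contract-alternates (pos (neg A)) = cong (_ ∷_) (contract-alternates (neg A))
contract-alternates (neg (pos A)) = cong (_ ∷_) (contract-alternates (pos A))

replicate-+ : ∀ {A : Set} j k {x : A} xs →
              replicate (j + k) x ++ xs ≡ replicate j x ++ (replicate k x ++ xs)
replicate-+ zero    k xs = refl
replicate-+ (suc j) k xs = cong (_ ∷_) (replicate-+ j k xs)

-- If an entry becomes zero, its two neighbours have equal signs and merge. The first entry keeps
-- its sign `c`, which the induction needs in order to put a further entry in front.
contract-step : ∀ {c} a α → Alternates c (a ∷ α) → (i : Fin (length α)) →
                Alternates c (contract (a ∷ (α [ i ]%= _*1))) ×
                word (contract (a ∷ (α [ i ]%= _*1))) ≡ word (a ∷ (α [ i ]%= _*1))
contract-step _ _ (pos (neg {zero} [])) zero = pos [] , refl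
contract-step _ _ (neg (pos {zero} [])) zero = neg [] , refl
contract-step _ _ (pos {j} (neg {zero} (pos {k} {α} A))) zero =
  pos A , replicate-+ (suc j) (suc k) (word α)
-- Two negative entries add up to `-[1+ suc (j + k) ]`, so the length is rearranged before the run
-- is split.
contract-step _ _ (neg {j} (pos {zero} (neg {k} {α} A))) zero =
  neg A , trans (cong (λ l → replicate l false ++ word α) (cong suc (sym (ℕ.+-suc j k))))
                (replicate-+ (suc j) (suc k) (word α))
contract-step _ _ (pos (neg {suc k} A)) zero
  rewrite contract-alternates (neg {k} A) = pos (neg A) , refl
contract-step _ _ (neg (pos {suc k} A)) zero
  rewrite contract-alternates (pos {k} A) = neg (pos A) , refl
contract-step a _ (pos A@(neg _)) (suc i) with contract-step _ _ A i
... | A′ , eq = pos A′ , cong (replicate ∣ a ∣ (sgn a) ++_) eq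
contract-step a _ (neg A@(pos _)) (suc i) with contract-step _ _ A i
... | A′ , eq = neg A′ , cong (replicate ∣ a ∣ (sgn a) ++_) eq

-- The leading sign `d` is existential because a first block of length one disappears and hands over
-- to a block of the opposite sign.
reduce-step : ∀ {c} α → Alternates c α → (i : Fin (length α)) →
              (∃[ d ] Alternates d (reduce (α [ i ]%= _*1))) ×
              word (reduce (α [ i ]%= _*1)) ≡ word (α [ i ]%= _*1)
reduce-step (+[1+ zero ] ∷ _) (pos A) zero = (_ , A) , refl
reduce-step (-[1+ zero ] ∷ _) (neg A) zero = (_ , A) , refl
reduce-step (+[1+ suc k ] ∷ _) (pos A) zero
  rewrite contract-alternates (pos {k} A) = (_ , pos A) , refl
reduce-step (-[1+ suc k ] ∷ _) (neg A) zero
  rewrite contract-alternates (neg {k} A) = (_ , neg A) , refl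
reduce-step (a@(+[1+ _ ]) ∷ α) A (suc i) with contract-step a α A i
... | A′ , eq = (_ , A′) , eq
reduce-step (a@(-[1+ _ ]) ∷ α) A (suc i) with contract-step a α A i
... | A′ , eq = (_ , A′) , eq

-- Deletes one letter from each maximal run in turn.
shorten : List Bool → List (List Bool)
shorten []                  = []
shorten (c ∷ [])            = [] ∷ []
shorten (true  ∷ true  ∷ w) = map (true ∷_) (shorten (true ∷ w))
shorten (true  ∷ false ∷ w) = (false ∷ w) ∷ map (true ∷_) (shorten (false ∷ w))
shorten (false ∷ true  ∷ w) = (true ∷ w) ∷ map (false ∷_) (shorten (true ∷ w))
shorten (false ∷ false ∷ w) = map (false ∷_) (shorten (false ∷ w))

-- The word of `α` is empty or starts with `not c`, so the displayed run is maximal and contributes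
-- exactly one shortened word.
shorten-run : ∀ {α} c k → Alternates (not c) α →
  shorten (replicate (suc k) c ++ word α) ≡
  (replicate k c ++ word α) ∷ map (replicate (suc k) c ++_) (shorten (word α))
shorten-run true  zero [] = refl
shorten-run true  zero (neg A) = refl
shorten-run false zero [] = refl
shorten-run false zero (pos A) = refl
shorten-run {α} true (suc k) A =
  trans (cong (map (true ∷_)) (shorten-run true k A))
        (cong₂ _∷_ refl (sym (map-∘ (shorten (word α)))))
shorten-run {α} false (suc k) A =
  trans (cong (map (false ∷_)) (shorten-run false k A))
        (cong₂ _∷_ refl (sym (map-∘ (shorten (word α)))))

-- The blocks of an alternating tuple are the maximal runs of its word; the shortened words
-- therefore come in the order of the summands of `𝓕`.
shorten-word : ∀ {c} α → Alternates c α →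
               shorten (word α) ≡ tabulate (λ (i : Fin (length α)) → word (α [ i ]%= _*1))
shorten-word []               []      = refl
shorten-word (+[1+ k ] ∷ α) (pos A) =
  trans (shorten-run true k A)
  (cong₂ _∷_ refl (trans (cong (map _) (shorten-word α A)) (map-tabulate _ _)))
-- `-[1+ k ] *1` is a negation that computes only after a case split on `k`.
shorten-word (-[1+ zero ] ∷ α) (neg A) =
  trans (shorten-run false zero A)
  (cong₂ _∷_ refl (trans (cong (map _) (shorten-word α A)) (map-tabulate _ _)))
shorten-word (-[1+ suc k ] ∷ α) (neg A) =
  trans (shorten-run false (suc k) A)
  (cong₂ _∷_ refl (trans (cong (map _) (shorten-word α A)) (map-tabulate _ _)))

length-word : ∀ α → length (word α) ≡ ‖ α ‖
length-word []      = refl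
length-word (a ∷ α) =
  trans (length-++ (replicate ∣ a ∣ (sgn a))) (cong₂ _+_ (length-replicate ∣ a ∣) (length-word α))

‖*1‖ : ∀ {c} α → Alternates c α → (i : Fin (length α)) → suc ‖ α [ i ]%= _*1 ‖ ≡ ‖ α ‖
‖*1‖ (+[1+ _ ] ∷ _)     (pos A) zero    = refl
‖*1‖ (-[1+ zero ] ∷ _)  (neg A) zero    = refl
‖*1‖ (-[1+ suc _ ] ∷ _) (neg A) zero    = refl
‖*1‖ (+[1+ k ] ∷ α)     (pos A) (suc i) =
  trans (sym (ℕ.+-suc (suc k) _)) (cong (λ l → suc k + l) (‖*1‖ α A i))
‖*1‖ (-[1+ k ] ∷ α)     (neg A) (suc i) =
  trans (sym (ℕ.+-suc (suc k) _)) (cong (λ l → suc k + l) (‖*1‖ α A i))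

-- `N m w` stands for the number of permutations of `0` to `m` with signature `w`.
module _ (N : ℕ → List Bool → ℕ) (N₀ : N 0 [] ≡ 1)
         (N-suc : ∀ m w → N (suc m) w ≡ sum (map (N m) (shorten w))) where

  -- A single run can be shortened in one way only, so the recursion descends without branching to
  -- `N 0 []`.
  N-run : ∀ c k → N k (replicate k c ++ []) ≡ 1
  N-run c zero    = N₀
  N-run c (suc k) =
    trans (N-suc k _)
    (trans (cong (sum ∘ map (N k)) (shorten-run {[]} c k []))
    (trans (ℕ.+-identityʳ _) (N-run c k)))

  -- Induction on the norm, with one block as a separate base case, as in the definition of `𝓕`. The
  -- norm is taken positive because `𝓕 []` is 0 whereas `N 0 []` is 1.
  𝓕-words : ∀ m {c} α → Alternates c α → ‖ α ‖ ≡ suc m → 𝓕 α ≡ N (suc m) (word α)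
  𝓕-words m (+[1+ k ] ∷ []) (pos []) eq
    rewrite sym eq | ℕ.+-identityʳ k = sym (N-run true (suc k))
  𝓕-words m (-[1+ k ] ∷ []) (neg []) eq
    rewrite sym eq | ℕ.+-identityʳ k = sym (N-run false (suc k))
  -- Two nonzero entries have norm at least 2.
  𝓕-words zero _ (pos {k} (neg _)) eq with () ← trans (sym (ℕ.+-suc k _)) (ℕ.suc-injective eq)
  𝓕-words zero _ (neg {k} (pos _)) eq with () ← trans (sym (ℕ.+-suc k _)) (ℕ.suc-injective eq)
  𝓕-words (suc m) α@(_ ∷ _ ∷ _) A eq = begin
    𝓕 α
      ≡⟨ 𝓕-recursion (alternates⇒𝕂 A) (s≤s (s≤s z≤n)) ⟩
    sum (tabulate λ (i : Fin (length α)) → 𝓕 (reduce (α [ i ]%= _*1)))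
      ≡⟨ cong sum (tabulate-cong ith) ⟩
    sum (tabulate λ (i : Fin (length α)) → N (suc m) (word (α [ i ]%= _*1)))
      ≡⟨ cong sum (map-tabulate (λ (i : Fin (length α)) → word (α [ i ]%= _*1)) (N (suc m))) ⟨
    sum (map (N (suc m)) (tabulate λ (i : Fin (length α)) → word (α [ i ]%= _*1)))
      ≡⟨ cong (sum ∘ map (N (suc m))) (shorten-word α A) ⟨
    sum (map (N (suc m)) (shorten (word α)))
      ≡⟨ N-suc (suc m) (word α) ⟨
    N (suc (suc m)) (word α) ∎
    where
    open ≡-Reasoning
    ith : ∀ i → 𝓕 (reduce (α [ i ]%= _*1)) ≡ N (suc m) (word (α [ i ]%= _*1))
    ith i with (_ , A′) , ≡word ← reduce-step α A i =
      trans (𝓕-words m _ A′ norm) (cong (N (suc m)) ≡word)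
      where
      -- The norm is the length of the word, and reduction preserves the word.
      norm : ‖ reduce (α [ i ]%= _*1) ‖ ≡ suc m
      norm = trans (trans (sym (length-word (reduce (α [ i ]%= _*1)))) (trans (cong length ≡word)
               (length-word (α [ i ]%= _*1)))) (ℕ.suc-injective (trans (‖*1‖ α A i) eq))

-- Reversal of words

word-++ : ∀ α β → word (α ++ β) ≡ word α ++ word β
word-++ []      β = refl
word-++ (a ∷ α) β = trans (cong (replicate ∣ a ∣ (sgn a) ++_) (word-++ α β))
                          (sym (++-assoc (replicate ∣ a ∣ (sgn a)) _ _))

reverse-replicate : ∀ {A : Set} k (x : A) → reverse (replicate k x) ≡ replicate k x
reverse-replicate zero    x = refl
reverse-replicate (suc k) x = trans (unfold-reverse x (replicate k x))
  (trans (cong (_∷ʳ x) (reverse-replicate k x)) (snoc k))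
  where
  snoc : ∀ k → replicate k x ∷ʳ x ≡ x ∷ replicate k x
  snoc zero    = refl
  snoc (suc k) = cong (x ∷_) (snoc k)

word-neg : ∀ a → replicate ∣ ℤ.- a ∣ (sgn (ℤ.- a)) ≡ map not (replicate ∣ a ∣ (sgn a))
word-neg +0       = refl
word-neg +[1+ k ] = sym (map-replicate not (suc k) true)
word-neg -[1+ k ] = sym (map-replicate not (suc k) false)

-- The signature of a sequence read backwards: the order of the steps is reversed and every ascent
-- becomes a descent.
mirror : List Bool → List Bool
mirror w = map not (reverse w)

word-mirror : ∀ α → word (map ℤ.-_ (reverse α)) ≡ mirror (word α)
word-mirror []      = refl
word-mirror (a ∷ α) = begin
  word (map ℤ.-_ (reverse (a ∷ α)))
    ≡⟨ cong (λ β → word (map ℤ.-_ β)) (unfold-reverse a α) ⟩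
  word (map ℤ.-_ (reverse α ∷ʳ a))
    ≡⟨ cong word (map-++ ℤ.-_ (reverse α) _) ⟩
  word (map ℤ.-_ (reverse α) ∷ʳ (ℤ.- a))
    ≡⟨ word-++ (map ℤ.-_ (reverse α)) _ ⟩
  word (map ℤ.-_ (reverse α)) ++ (replicate ∣ ℤ.- a ∣ (sgn (ℤ.- a)) ++ [])
    ≡⟨ cong₂ _++_ (word-mirror α) (trans (++-identityʳ _) (word-neg a)) ⟩
  mirror (word α) ++ map not r
    ≡⟨ map-++ not (reverse (word α)) r ⟨
  map not (reverse (word α) ++ r)
    ≡⟨ cong (λ v → map not (reverse (word α) ++ v)) (reverse-replicate ∣ a ∣ (sgn a)) ⟨
  map not (reverse (word α) ++ reverse r)
    ≡⟨ cong (map not) (reverse-++ r (word α)) ⟨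
  mirror (r ++ word α) ∎
  where
  open ≡-Reasoning
  r = replicate ∣ a ∣ (sgn a)

alternates-mirror : ∀ {c} α → Alternates c α → ∃[ d ] Alternates d (map ℤ.-_ (reverse α))
alternates-mirror α A = go α [] A []
  where
  -- The entry moved last onto `β` has the sign opposite to the next entry of `α`; after negation
  -- the signs agree, so one `c` serves both lists.
  go : ∀ {c} α β → Alternates c α → Alternates c (map ℤ.-_ β) →
       ∃[ d ] Alternates d (map ℤ.-_ (α ʳ++ β))
  go []      β []      B = _ , B
  go (_ ∷ α) β (pos A) B = go α (_ ∷ β) A (neg B)
  go (_ ∷ α) β (neg A) B = go α (_ ∷ β) A (pos B)

-- What follows each run is empty or begins with the other letter, so the length of the run can be
-- read off.
run-injective : ∀ {α β} c k l → Alternates (not c) α → Alternates (not c) β →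
  replicate k c ++ word α ≡ replicate l c ++ word β → k ≡ l × word α ≡ word β
run-injective c     zero    zero    A       B       eq = refl , eq
run-injective c     (suc k) (suc l) A       B       eq
  with k≡l , eq′ ← run-injective c k l A B (∷-injectiveʳ eq) = cong suc k≡l , eq′
run-injective true  zero    (suc l) (neg A) B       ()
run-injective false zero    (suc l) (pos A) B       ()
run-injective true  (suc k) zero    A       (neg B) ()
run-injective false (suc k) zero    A       (pos B) ()

-- An alternating tuple is the run-length encoding of its word.
word-injective : ∀ {c d} {α β} → Alternates c α → Alternates d β → word α ≡ word β → α ≡ β
word-injective []      []      eq = refl
word-injective (pos {k} A) (pos {l} B) eq with run-injective true k l A B (∷-injectiveʳ eq)
... | refl , eq′ = cong (_ ∷_) (word-injective A B eq′)
word-injective (neg {k} A) (neg {l} B) eq with run-injective false k l A B (∷-injectiveʳ eq)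
... | refl , eq′ = cong (_ ∷_) (word-injective A B eq′)

mirror⇒symmetric : ∀ {c α} → Alternates c α → word α ≡ mirror (word α) → Symmetric α
mirror⇒symmetric {α = α} A eq =
  word-injective A (proj₂ (alternates-mirror α A)) (trans eq (sym (word-mirror α)))

-- Enumeration of the permutations with a given signature

Step : Bool → ℕ → ℕ → Set
Step true  x y = x < y
Step false x y = y < x

data Signature : List Bool → List ℕ → Set where
  [-] : ∀ {x} → Signature [] (x ∷ [])
  _∷_ : ∀ {c w x y xs} → Step c x y → Signature w (y ∷ xs) → Signature (c ∷ w) (x ∷ y ∷ xs)

Step-unique : ∀ {c d x y} → Step c x y → Step d x y → c ≡ d
Step-unique {true}  {true}  _ _ = refl
Step-unique {true}  {false} p q = ⊥-elim (ℕ.<-asym p q)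
Step-unique {false} {true}  p q = ⊥-elim (ℕ.<-asym p q)
Step-unique {false} {false} _ _ = refl

Signature-unique : ∀ {v w xs} → Signature v xs → Signature w xs → v ≡ w
Signature-unique [-]      [-]      = refl
Signature-unique (p ∷ ps) (q ∷ qs) = cong₂ _∷_ (Step-unique p q) (Signature-unique ps qs)

length-Signature : ∀ {w xs} → Signature w xs → length xs ≡ suc (length w)
length-Signature [-]      = refl
length-Signature (_ ∷ ps) = cong suc (length-Signature ps)

-- `suc m` distinct values that are at most `m` are exactly `0` to `m`, each taken once.
record IsPermutation (m : ℕ) (w : List Bool) (xs : List ℕ) : Set where
  field
    signature : Signature w xs
    unique    : Unique xs
    bounded   : All (_≤ m) xs
    length≡   : length xs ≡ suc m

open IsPermutation

-- Insertion of a new maximum at a peak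

insert : ℕ → ℕ → List ℕ → List ℕ
insert m zero    xs       = m ∷ xs
insert m (suc p) []       = m ∷ []
insert m (suc p) (x ∷ xs) = x ∷ insert m p xs

insert-↭ : ∀ m p xs → insert m p xs ↭ m ∷ xs
insert-↭ m zero    xs       = ↭-refl
insert-↭ m (suc p) []       = ↭-refl
insert-↭ m (suc p) (x ∷ xs) = ↭-trans (prep x (insert-↭ m p xs)) (swap x m ↭-refl)

-- The inserted value exceeds all others, so its position in the result is recognisable.
insert-injective : ∀ {m} p q {xs ys} → p ≤ length xs → q ≤ length ys →
                   All (_< m) xs → All (_< m) ys →
                   insert m p xs ≡ insert m q ys → p ≡ q × xs ≡ ys
insert-injective zero    zero    _ _ _ _ eq = refl , ∷-injectiveʳ eq
insert-injective zero    (suc q) {ys = _ ∷ _} _ _ _ (y<m ∷ _) eq =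
  ⊥-elim (ℕ.<-irrefl (sym (∷-injectiveˡ eq)) y<m)
insert-injective (suc p) zero    {xs = _ ∷ _} _ _ (x<m ∷ _) _ eq =
  ⊥-elim (ℕ.<-irrefl (∷-injectiveˡ eq) x<m)
insert-injective (suc p) (suc q) {_ ∷ _} {_ ∷ _} (s≤s p≤) (s≤s q≤) (_ ∷ xs<) (_ ∷ ys<) eq
  with refl ← ∷-injectiveˡ eq
  with refl , refl ← insert-injective p q p≤ q≤ xs< ys< (∷-injectiveʳ eq) = refl , refl

-- In peaks w and innerPeaks w, an entry (p , v) says that inserting a new maximum at position p
-- into a sequence of signature v results in signature w. The positions of innerPeaks are
-- relative to the tail of the sequence.
peakAfter : Bool → List Bool → List (ℕ × List Bool)
peakAfter true  []          = (0 , []) ∷ []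
peakAfter true  (false ∷ w) = (0 , false ∷ w) ∷ (0 , true ∷ w) ∷ []
peakAfter true  (true ∷ _)  = []
peakAfter false _           = []

shift : Bool → ℕ × List Bool → ℕ × List Bool
shift c (p , v) = suc p , c ∷ v

innerPeaks : List Bool → List (ℕ × List Bool)
innerPeaks []      = []
innerPeaks (c ∷ w) = peakAfter c w ++ map (shift c) (innerPeaks w)

firstPeak : List Bool → List (ℕ × List Bool)
firstPeak (false ∷ w) = (0 , w) ∷ []
firstPeak _           = []

peaks : List Bool → List (ℕ × List Bool)
peaks w = firstPeak w ++ map (map₁ suc) (innerPeaks w)

innerPeaks-shift : ∀ c ps → map proj₂ (map (shift c) ps) ≡ map (c ∷_) (map proj₂ ps)
innerPeaks-shift c ps = trans (sym (map-∘ ps)) (map-∘ ps)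

-- An ascending run is shortened at the peak on its right, a descending run at the peak on its left.
-- A leading descending run has its peak at the very first position, which `innerPeaks` omits; in
-- the second statement its shortened word `w` is added in front.
innerPeaks-shorten⁺ : ∀ w → map proj₂ (innerPeaks (true ∷ w)) ≡ shorten (true ∷ w)
innerPeaks-shorten⁻ : ∀ w → w ∷ map proj₂ (innerPeaks (false ∷ w)) ≡ shorten (false ∷ w)

innerPeaks-shorten⁺ []          = refl
innerPeaks-shorten⁺ (true ∷ w)  =
  trans (innerPeaks-shift true _) (cong (map (true ∷_)) (innerPeaks-shorten⁺ w))
innerPeaks-shorten⁺ (false ∷ w) =
  cong ((false ∷ w) ∷_) (trans (cong ((true ∷ w) ∷_) (innerPeaks-shift true _))
                               (cong (map (true ∷_)) (innerPeaks-shorten⁻ w)))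

innerPeaks-shorten⁻ []          = refl
innerPeaks-shorten⁻ (true ∷ w)  =
  cong ((true ∷ w) ∷_) (trans (innerPeaks-shift false _)
                              (cong (map (false ∷_)) (innerPeaks-shorten⁺ w)))
innerPeaks-shorten⁻ (false ∷ w) =
  trans (cong ((false ∷ w) ∷_) (innerPeaks-shift false _))
        (cong (map (false ∷_)) (innerPeaks-shorten⁻ w))

peaks-shorten : ∀ w → map proj₂ (peaks w) ≡ shorten w
peaks-shorten []          = refl
peaks-shorten (true ∷ w)  = trans (sym (map-∘ (innerPeaks (true ∷ w)))) (innerPeaks-shorten⁺ w)
peaks-shorten (false ∷ w) =
  trans (cong (w ∷_) (sym (map-∘ (innerPeaks (false ∷ w))))) (innerPeaks-shorten⁻ w)

peakAfter-zero : ∀ c w {p v} → (p , v) ∈ peakAfter c w → p ≡ 0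
peakAfter-zero true []          (here refl)         = refl
peakAfter-zero true (false ∷ _) (here refl)         = refl
peakAfter-zero true (false ∷ _) (there (here refl)) = refl

innerPeaks-position : ∀ w {p v} → (p , v) ∈ innerPeaks w → p ≤ length v
innerPeaks-position (c ∷ w) pv∈ with ∈-++⁻ (peakAfter c w) pv∈
... | inj₁ at rewrite peakAfter-zero c w at = z≤n
... | inj₂ later with _ , qv∈ , refl ← ∈-map⁻ (shift c) later = s≤s (innerPeaks-position w qv∈)

peaks-position : ∀ w {p v} → (p , v) ∈ peaks w → p ≤ suc (length v)
peaks-position w pv∈ with ∈-++⁻ (firstPeak w) pv∈
peaks-position (false ∷ _) _ | inj₁ (here refl) = z≤n
peaks-position w _ | inj₂ inner
  with _ , qv∈ , refl ← ∈-map⁻ (map₁ suc) inner = s≤s (innerPeaks-position w qv∈)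

peakAfter-unique : ∀ c w → Unique (peakAfter c w)
peakAfter-unique true  []          = [] ∷ []
peakAfter-unique true  (false ∷ w) = ((λ ()) ∷ []) ∷ [] ∷ []
peakAfter-unique true  (true ∷ _)  = []
peakAfter-unique false _           = []

innerPeaks-unique : ∀ w → Unique (innerPeaks w)
innerPeaks-unique []      = []
innerPeaks-unique (c ∷ w) =
  Unique.++⁺ (peakAfter-unique c w) (Unique.map⁺ (λ { refl → refl }) (innerPeaks-unique w)) disjoint
  where
  disjoint : ∀ {pv} → ¬ (pv ∈ peakAfter c w × pv ∈ map (shift c) (innerPeaks w))
  disjoint (at , later) with _ , _ , refl ← ∈-map⁻ (shift c) later with () ← peakAfter-zero c w at

peaks-unique : ∀ w → Unique (peaks w)
peaks-unique w =
  Unique.++⁺ (first-unique w) (Unique.map⁺ (λ { refl → refl }) (innerPeaks-unique w)) (disjoint w)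
  where
  first-unique : ∀ w → Unique (firstPeak w)
  first-unique []          = []
  first-unique (true ∷ _)  = []
  first-unique (false ∷ _) = [] ∷ []
  disjoint : ∀ w {pv} → ¬ (pv ∈ firstPeak w × pv ∈ map (map₁ suc) (innerPeaks w))
  disjoint (false ∷ w) (here refl , later)
    with _ , _ , () ← ∈-map⁻ (map₁ suc) later

-- An interrupted step may have either direction: both of its ends lie below the maximum, so an
-- ascent followed by a descent takes its place.
innerPeaks-sound : ∀ {m} w {p v x xs} → (p , v) ∈ innerPeaks w → Signature v (x ∷ xs) →
                   All (_< m) (x ∷ xs) → Signature w (x ∷ insert m p xs)
innerPeaks-sound (c ∷ w) pv∈ sig b with ∈-++⁻ (peakAfter c w) pv∈
innerPeaks-sound (true ∷ []) _ [-] (x<m ∷ _) | inj₁ (here refl) = x<m ∷ [-]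
innerPeaks-sound (true ∷ false ∷ w) _ (_ ∷ sig) (x<m ∷ y<m ∷ _) | inj₁ (here refl) =
  x<m ∷ y<m ∷ sig
innerPeaks-sound (true ∷ false ∷ w) _ (_ ∷ sig) (x<m ∷ y<m ∷ _) | inj₁ (there (here refl)) =
  x<m ∷ y<m ∷ sig
innerPeaks-sound (c ∷ w) _ sig b | inj₂ later
  with _ , qv∈ , refl ← ∈-map⁻ (shift c) later
  with st ∷ sig′ ← sig | _ ∷ b′ ← b = st ∷ innerPeaks-sound w qv∈ sig′ b′

peaks-sound : ∀ {m} w {p v xs} → (p , v) ∈ peaks w → Signature v xs →
              All (_< m) xs → Signature w (insert m p xs)
peaks-sound w {xs = _ ∷ _} pv∈ sig b with ∈-++⁻ (firstPeak w) pv∈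
peaks-sound (false ∷ _) {xs = _ ∷ _} _ sig (x<m ∷ _) | inj₁ (here refl) = x<m ∷ sig
peaks-sound w {xs = _ ∷ _} _ sig b | inj₂ inner
  with _ , qv∈ , refl ← ∈-map⁻ (map₁ suc) inner = innerPeaks-sound w qv∈ sig b

-- A maximum is neither reached by a descent nor left by an ascent. If it stands between `x` and
-- `z`, its deletion makes these two adjacent, and comparing them tells which of the two words of
-- the peak is the signature left over.
innerPeaks-complete : ∀ {m w x xs} → Signature w (x ∷ xs) → Unique (x ∷ xs) →
  All (_≤ m) (x ∷ xs) → m ∈ xs →
  ∃[ p ] ∃[ v ] ∃[ ys ] (p , v) ∈ innerPeaks w × Signature v (x ∷ ys) × xs ≡ insert m p ys
innerPeaks-complete (_∷_ {c = false} y<x _) _ (x≤m ∷ _) (here refl) = ⊥-elim (ℕ.<⇒≱ y<x x≤m)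
innerPeaks-complete (_∷_ {c = true} x<m [-]) _ _ (here refl) =
  0 , [] , [] , here refl , [-] , refl
innerPeaks-complete (_∷_ {c = true} x<m (_∷_ {c = true} m<z _)) _ (_ ∷ _ ∷ z≤m ∷ _) (here refl) =
  ⊥-elim (ℕ.<⇒≱ m<z z≤m)
innerPeaks-complete {x = x} (_∷_ {c = true} x<m (_∷_ {c = false} {y = z} z<m sig))
                    ((_ ∷ x≢z ∷ _) ∷ _) _ (here refl) with ℕ.<-cmp x z
... | tri< x<z _ _ = 0 , true ∷ _ , _ , there (here refl) , x<z ∷ sig , refl
... | tri≈ _ x≡z _ = ⊥-elim (x≢z x≡z)
... | tri> _ _ z<x = 0 , false ∷ _ , _ , here refl , z<x ∷ sig , refl
innerPeaks-complete (_∷_ {c = c} {w = w} st sig) (_ ∷ u) (_ ∷ b) (there m∈)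
  with p , v , ys , pv∈ , sig′ , eq ← innerPeaks-complete sig u b m∈ =
  suc p , c ∷ v , _ ∷ ys ,
  ∈-++⁺ʳ (peakAfter c w) (∈-map⁺ (shift c) pv∈) , st ∷ sig′ , cong (_ ∷_) eq

-- With at least two entries, the deletion leaves a nonempty sequence, which has a signature.
peaks-complete : ∀ {m w x y xs} → Signature w (x ∷ y ∷ xs) → Unique (x ∷ y ∷ xs) →
  All (_≤ m) (x ∷ y ∷ xs) → m ∈ x ∷ y ∷ xs →
  ∃[ p ] ∃[ v ] ∃[ ys ] (p , v) ∈ peaks w × Signature v ys × x ∷ y ∷ xs ≡ insert m p ys
peaks-complete (_∷_ {c = false} y<x sig) _ _ (here refl) =
  0 , _ , _ , here refl , sig , refl
peaks-complete (_∷_ {c = true} x<y _) _ (_ ∷ y≤x ∷ _) (here refl) = ⊥-elim (ℕ.<⇒≱ x<y y≤x)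
peaks-complete {w = w} sig u b (there m∈)
  with p , v , ys , pv∈ , sig′ , eq ← innerPeaks-complete sig u b m∈ =
  suc p , v , _ ∷ ys , ∈-++⁺ʳ (firstPeak w) (∈-map⁺ (map₁ suc) pv∈) , sig′ , cong (_ ∷_) eq

-- Recursive enumeration and its correctness

insertAll : ℕ → (List Bool → List (List ℕ)) → ℕ × List Bool → List (List ℕ)
insertAll m E (p , v) = map (insert m p) (E v)

permutations : ℕ → List Bool → List (List ℕ)
permutations zero    []      = (0 ∷ []) ∷ []
permutations zero    (_ ∷ _) = []
permutations (suc m) w       = concatMap (insertAll (suc m) (permutations m)) (peaks w)

permutations-sound : ∀ m w {xs} → xs ∈ permutations m w → IsPermutation m w xs
permutations-sound zero    []      (here refl) = record
  { signature = [-] ; unique = [] ∷ [] ; bounded = z≤n ∷ [] ; length≡ = refl }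
permutations-sound (suc m) w       xs∈
  with (p , v) , pv∈ , xs∈′ ← find (∈-concatMap⁻ (insertAll (suc m) (permutations m)) {peaks w} xs∈)
  with ys , ys∈ , refl ← ∈-map⁻ (insert (suc m) p) xs∈′ = record
  { signature = peaks-sound w pv∈ (signature P) ys<
  ; unique    = Unique-resp-↭ (↭-sym ins) (All.map ℕ.>⇒≢ ys< ∷ unique P)
  ; bounded   = All-resp-↭ (↭-sym ins) (ℕ.≤-refl ∷ All.map ℕ.<⇒≤ ys<)
  ; length≡   = trans (↭-length ins) (cong suc (length≡ P))
  }
  where
  P   = permutations-sound m v ys∈
  ins = insert-↭ (suc m) p ys
  ys< = All.map s≤s (bounded P)

permutations-complete : ∀ m w {xs} → IsPermutation m w xs → xs ∈ permutations m w
permutations-complete zero w {x ∷ []} P with signature P | bounded P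
... | [-] | z≤n ∷ [] = here refl
permutations-complete zero w {x ∷ y ∷ xs} P with () ← length≡ P
permutations-complete (suc m) w {[]} P with () ← length≡ P
permutations-complete (suc m) w {x ∷ []} P with () ← length≡ P
permutations-complete (suc m) w {x ∷ y ∷ xs} P with DecMembership._∈?_ (suc m) (x ∷ y ∷ xs)
-- Otherwise `suc (suc m)` distinct entries would all be smaller than `suc m`.
... | no m∉ = ⊥-elim (ℕ.1+n≰n (subst (_≤ suc m) (length≡ P)
  (unique-bounded⇒length≤ (unique P) (All.tabulate λ z∈ →
    ℕ.≤∧≢⇒< (All.lookup (bounded P) z∈) λ { refl → m∉ z∈ }))))
... | yes m∈
  with p , v , ys , pv∈ , sig , eq ← peaks-complete (signature P) (unique P) (bounded P) m∈
  with P′ ← subst (IsPermutation (suc m) w) eq P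
  with m∉ys ∷ u ← Unique-resp-↭ (insert-↭ (suc m) p ys) (unique P′)
  with _ ∷ b ← All-resp-↭ (insert-↭ (suc m) p ys) (bounded P′) =
  subst (_∈ permutations (suc m) w) (sym eq)
    (∈-concatMap⁺ (insertAll (suc m) (permutations m)) {peaks w}
    (lose pv∈ (∈-map⁺ (insert (suc m) p) (permutations-complete m v record
      { signature = sig
      ; unique    = u
      ; bounded   = All.zipWith (λ { (≢m , ≤m) → ℕ.≤-pred (ℕ.≤∧≢⇒< ≤m (≢m ∘ sym)) }) (m∉ys , b)
      ; length≡   = ℕ.suc-injective (trans (sym (↭-length (insert-↭ (suc m) p ys))) (length≡ P′))
      }))))

-- The position and the shorter permutation are recovered from the result, and the word `v` is then
-- the signature of that permutation.
permutations-insert-injective : ∀ {m} w {p q v v′ xs ys} → (p , v) ∈ peaks w → (q , v′) ∈ peaks w →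
  xs ∈ permutations m v → ys ∈ permutations m v′ → insert (suc m) p xs ≡ insert (suc m) q ys →
  (p , v) ≡ (q , v′) × xs ≡ ys
permutations-insert-injective {m} w {p} {q} {v} {v′} pv∈ qv∈ xs∈ ys∈ eq
  with P ← permutations-sound m v xs∈ | Q ← permutations-sound m v′ ys∈
  with refl , refl ← insert-injective p q
         (subst (p ≤_) (sym (length-Signature (signature P))) (peaks-position w pv∈))
         (subst (q ≤_) (sym (length-Signature (signature Q))) (peaks-position w qv∈))
         (All.map s≤s (bounded P)) (All.map s≤s (bounded Q)) eq
  = cong (p ,_) (Signature-unique (signature P) (signature Q)) , refl

permutations-unique : ∀ m w → Unique (permutations m w)
permutations-unique zero    []      = [] ∷ []
permutations-unique zero    (_ ∷ _) = []
permutations-unique (suc m) w       = concatMap-unique _ (peaks-unique w)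
  (λ {(p , v)} pv∈ → map-unique _ (permutations-unique m v)
    λ xs∈ ys∈ eq → proj₂ (permutations-insert-injective w pv∈ pv∈ xs∈ ys∈ eq))
  λ pv∈ qv∈ zs∈ zs∈′ → disjoint pv∈ qv∈ (∈-map⁻ _ zs∈) (∈-map⁻ _ zs∈′)
  where
  disjoint : ∀ {p q v v′ zs} → (p , v) ∈ peaks w → (q , v′) ∈ peaks w →
             ∃[ xs ] (xs ∈ permutations m v × zs ≡ insert (suc m) p xs) →
             ∃[ ys ] (ys ∈ permutations m v′ × zs ≡ insert (suc m) q ys) → (p , v) ≡ (q , v′)
  disjoint pv∈ qv∈ (_ , xs∈ , eq) (_ , ys∈ , eq′) =
    proj₁ (permutations-insert-injective w pv∈ qv∈ xs∈ ys∈ (trans (sym eq) eq′))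

-- This is the recursion required of `N`: the lengths add up over the peaks, whose words are those
-- of `shorten`.
length-permutations : ∀ m w → length (permutations (suc m) w) ≡
                      sum (map (length ∘ permutations m) (shorten w))
length-permutations m w =
  trans (go (peaks w)) (cong (sum ∘ map (length ∘ permutations m)) (peaks-shorten w))
  where
  go : ∀ ps → length (concatMap (insertAll (suc m) (permutations m)) ps) ≡
              sum (map (length ∘ permutations m) (map proj₂ ps))
  go []             = refl
  go ((p , v) ∷ ps) = trans (length-++ (map (insert (suc m) p) (permutations m v)))
                            (cong₂ _+_ (length-map _ (permutations m v)) (go ps))

-- Reversal of permutations

Step-not : ∀ {c x y} → Step c x y → Step (not c) y x
Step-not {true}  p = p
Step-not {false} p = p

Signature-∷ʳ : ∀ {c w x y} xs → Signature w (xs ∷ʳ x) → Step c x y →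
               Signature (w ∷ʳ c) (xs ∷ʳ x ∷ʳ y)
Signature-∷ʳ []           [-]      q = q ∷ [-]
Signature-∷ʳ (_ ∷ [])     (p ∷ ps) q = p ∷ Signature-∷ʳ [] ps q
Signature-∷ʳ (_ ∷ _ ∷ xs) (p ∷ ps) q = p ∷ Signature-∷ʳ (_ ∷ xs) ps q

Signature-reverse : ∀ {w xs} → Signature w xs → Signature (mirror w) (reverse xs)
Signature-reverse [-] = [-]
Signature-reverse (_∷_ {c} {w} {x} {y} {xs} p ps)
  rewrite unfold-reverse c w | map-++ not (reverse w) (c ∷ [])
        | unfold-reverse x (y ∷ xs) | unfold-reverse y xs =
  Signature-∷ʳ (reverse xs) (subst (Signature _) (unfold-reverse y xs) (Signature-reverse ps))
               (Step-not {c} p)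

IsPermutation-reverse : ∀ {m w xs} → IsPermutation m w xs → IsPermutation m (mirror w) (reverse xs)
IsPermutation-reverse {xs = xs} P = record
  { signature = Signature-reverse (signature P)
  ; unique    = Unique-resp-↭ (↭-sym (↭-reverse xs)) (unique P)
  ; bounded   = All-resp-↭ (↭-sym (↭-reverse xs)) (bounded P)
  ; length≡   = trans (length-reverse xs) (length≡ P)
  }

-- Paths and their edges

module _ {V : Set} where

  data Consecutive (u v : V) : List V → Set where
    here  : ∀ {xs} → Consecutive u v (u ∷ v ∷ xs)
    there : ∀ {x xs} → Consecutive u v xs → Consecutive u v (x ∷ xs)

  Adjacent : List V → V → V → Set
  Adjacent xs u v = Consecutive u v xs ⊎ Consecutive v u xs

  Consecutive⇒∈ˡ : ∀ {u v xs} → Consecutive u v xs → u ∈ xs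
  Consecutive⇒∈ˡ here      = here refl
  Consecutive⇒∈ˡ (there c) = there (Consecutive⇒∈ˡ c)

  Consecutive⇒∈ʳ : ∀ {u v x xs} → Consecutive u v (x ∷ xs) → v ∈ xs
  Consecutive⇒∈ʳ here              = here refl
  Consecutive⇒∈ʳ {xs = _ ∷ _} (there c) = there (Consecutive⇒∈ʳ c)

  Consecutive-++⁺ : ∀ {u v} xs {ys} → Consecutive u v ys → Consecutive u v (xs ++ ys)
  Consecutive-++⁺ []       c = c
  Consecutive-++⁺ (_ ∷ xs) c = there (Consecutive-++⁺ xs c)

  Consecutive-split : ∀ {u v xs} → Consecutive u v xs → ∃[ ys ] ∃[ zs ] xs ≡ ys ++ u ∷ v ∷ zs
  Consecutive-split here      = [] , _ , refl
  Consecutive-split (there c) with ys , zs , eq ← Consecutive-split c = _ ∷ ys , zs , cong (_ ∷_) eq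

  Consecutive-reverse : ∀ {u v xs} → Consecutive u v xs → Consecutive v u (reverse xs)
  Consecutive-reverse {u} {v} c with ys , zs , refl ← Consecutive-split c =
    subst (Consecutive v u) (sym (trans (++-ʳ++ ys) (ʳ++-defn zs)))
      (Consecutive-++⁺ (reverse zs) here)

  Adjacent-reverse : ∀ {xs u v} → Adjacent xs u v → Adjacent (reverse xs) u v
  Adjacent-reverse = Sum.swap ∘ Sum.map Consecutive-reverse Consecutive-reverse

  Adjacent-reverse⁻ : ∀ {xs u v} → Adjacent (reverse xs) u v → Adjacent xs u v
  Adjacent-reverse⁻ {xs} a =
    subst (λ l → Adjacent l _ _) (reverse-involutive xs) (Adjacent-reverse a)

  -- Both orders together would make a vertex occur twice.
  Consecutive-asym : ∀ {u v xs} → Unique xs → Consecutive u v xs → ¬ Consecutive v u xs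
  Consecutive-asym ((u≢u ∷ _) ∷ _) here here     = u≢u refl
  Consecutive-asym (u∉ ∷ _) here      (there c)  = All.lookup u∉ (there (Consecutive⇒∈ʳ c)) refl
  Consecutive-asym (u∉ ∷ _) (there c) here       = All.lookup u∉ (there (Consecutive⇒∈ʳ c)) refl
  Consecutive-asym (_ ∷ us) (there c) (there c′) = Consecutive-asym us c c′

  -- The first vertex is an end of the path and does not occur again, so only its successor is
  -- adjacent to it.
  head-neighbour : ∀ {x y z xs} → Unique (x ∷ y ∷ xs) → Adjacent (x ∷ y ∷ xs) x z → y ≡ z
  head-neighbour u        (inj₁ here)      = refl
  head-neighbour (x∉ ∷ _) (inj₁ (there c)) = ⊥-elim (All.lookup x∉ (Consecutive⇒∈ˡ c) refl)
  head-neighbour (x∉ ∷ _) (inj₂ c)         = ⊥-elim (All.lookup x∉ (Consecutive⇒∈ʳ c) refl)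

  predecessor : ∀ {u v x xs} → Consecutive u v xs → ∃[ t ] Consecutive t u (x ∷ xs)
  predecessor here      = _ , here
  predecessor (there c) with t , c′ ← predecessor c = t , there c′

  Adjacent⇒∈ : ∀ {u v xs} → Adjacent xs u v → u ∈ xs × v ∈ xs
  Adjacent⇒∈ {xs = _ ∷ _} (inj₁ c) = Consecutive⇒∈ˡ c , there (Consecutive⇒∈ʳ c)
  Adjacent⇒∈ {xs = _ ∷ _} (inj₂ c) = there (Consecutive⇒∈ʳ c) , Consecutive⇒∈ˡ c

  infix 4 _⊑_

  -- Inclusion of the sets of undirected edges.
  _⊑_ : List V → List V → Set
  xs ⊑ ys = ∀ {u v} → Adjacent xs u v → Adjacent ys u v

  ≡⇒⊑ : ∀ {xs ys} → xs ≡ ys → xs ⊑ ys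
  ≡⇒⊑ refl a = a

  -- An edge within `xs` avoids `x`, hence it is not the first edge of `x ∷ ys`.
  ⊑-tail : ∀ {x xs ys} → Unique (x ∷ xs) → x ∷ xs ⊑ x ∷ ys → xs ⊑ ys
  ⊑-tail (x∉ ∷ _) sub a with sub (Sum.map there there a)
  ... | inj₁ (there c) = inj₁ c
  ... | inj₂ (there c) = inj₂ c
  ... | inj₁ here      = ⊥-elim (All.lookup x∉ (proj₁ (Adjacent⇒∈ a)) refl)
  ... | inj₂ here      = ⊥-elim (All.lookup x∉ (proj₂ (Adjacent⇒∈ a)) refl)

  -- The path is retraced from its common end: the next vertex is the only neighbour of the end, and
  -- the end is then removed.
  same-head : ∀ {x} xs ys → Unique (x ∷ xs) → Unique (x ∷ ys) →
              x ∷ xs ⊑ x ∷ ys → x ∷ ys ⊑ x ∷ xs → xs ≡ ys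
  same-head []       []       _ _ _ _ = refl
  same-head []       (_ ∷ _)  _ _ _ sup with sup (inj₁ here)
  ... | inj₁ (there ())
  ... | inj₂ (there ())
  same-head (_ ∷ _)  []       _ _ sub _ with sub (inj₁ here)
  ... | inj₁ (there ())
  ... | inj₂ (there ())
  same-head (y ∷ xs) (z ∷ ys) u@(_ ∷ u′) v@(_ ∷ v′) sub sup
    with refl ← head-neighbour v (sub (inj₁ here)) =
    cong (y ∷_) (same-head xs ys u′ v′ (⊑-tail u sub) (⊑-tail v sup))

  -- The first vertex x has the single neighbour x′, so it cannot be preceded by a vertex in ys.
  same-start : ∀ {x x′ xs ys} → Unique (x ∷ x′ ∷ xs) → Unique ys →
               x ∷ x′ ∷ xs ⊑ ys → ys ⊑ x ∷ x′ ∷ xs → Consecutive x x′ ys → x ∷ x′ ∷ xs ≡ ys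
  same-start u v sub sup here = cong₂ _∷_ refl (same-head _ _ u v sub sup)
  same-start u v sub sup c@(there c′) with t , p ← predecessor c′
    with refl ← head-neighbour u (sup (inj₂ p)) = ⊥-elim (Consecutive-asym v c p)

  -- The first edge occurs in `ys` in one of two orders. In the opposite order, reversing `ys`
  -- reduces to the case of equal order.
  path-from-edges : ∀ {x x′ xs ys} → Unique (x ∷ x′ ∷ xs) → Unique ys →
                    x ∷ x′ ∷ xs ⊑ ys → ys ⊑ x ∷ x′ ∷ xs →
                    x ∷ x′ ∷ xs ≡ ys ⊎ x ∷ x′ ∷ xs ≡ reverse ys
  path-from-edges u v sub sup with sub (inj₁ here)
  ... | inj₁ c = inj₁ (same-start u v sub sup c)
  ... | inj₂ c = inj₂ (same-start u (Unique-resp-↭ (↭-sym (↭-reverse _)) v)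
                         (λ a → Adjacent-reverse (sub a)) (λ a → sup (Adjacent-reverse⁻ a))
                         (Consecutive-reverse c))

-- Oriented paths in transitive tournaments

module _ {n : ℕ} where

  Stepᶠ : Bool → Rel (Fin n) 0ℓ
  Stepᶠ c x y = Step c (toℕ x) (toℕ y)

  walk⇒signature : ∀ {c k v x y ys} (p : Walk (Stepᶠ c) k x y) → Signature v (map toℕ (y ∷ ys)) →
                   Signature (replicate k c ++ v) (map toℕ (x ∷ later p ++ ys))
  walk⇒signature stop       sig = sig
  walk⇒signature (step r p) sig = r ∷ walk⇒signature p sig

  signature⇒walk : ∀ {c} k {v x xs} → Signature (replicate k c ++ v) (map toℕ (x ∷ xs)) →
                   ∃[ y ] Σ[ p ∈ Walk (Stepᶠ c) k x y ] ∃[ ys ]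
                   xs ≡ later p ++ ys × Signature v (map toℕ (y ∷ ys))
  signature⇒walk zero    sig = _ , stop , _ , refl , sig
  signature⇒walk (suc k) {xs = _ ∷ _} (r ∷ sig)
    with y , p , ys , eq , sig′ ← signature⇒walk k sig = y , step r p , ys , cong (_ ∷_) eq , sig′

  blocks⇒signature : ∀ {α x y} (bs : Blocks (TT n) α x y) →
                     Signature (word α) (map toℕ (x ∷ blocksLater (TT n) bs))
  blocks⇒signature []                       = [-]
  blocks⇒signature (_∷_ {a = + _} I Is)      = walk⇒signature {true} I (blocks⇒signature Is)
  blocks⇒signature (_∷_ {a = -[1+ _ ]} I Is) = walk⇒signature {false} I (blocks⇒signature Is)

  signature⇒blocks : ∀ α {x xs} → Signature (word α) (map toℕ (x ∷ xs)) →
                     ∃[ y ] Σ[ bs ∈ Blocks (TT n) α x y ] blocksLater (TT n) bs ≡ xs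
  signature⇒blocks [] {xs = []} [-] = _ , [] , refl
  signature⇒blocks (+ k ∷ α) sig
    with _ , I , _ , refl , sig′ ← signature⇒walk {true} k sig
    with z , Is , refl ← signature⇒blocks α sig′ = z , I ∷ Is , refl
  signature⇒blocks (-[1+ k ] ∷ α) sig
    with _ , I , _ , refl , sig′ ← signature⇒walk {false} (suc k) sig
    with z , Is , refl ← signature⇒blocks α sig′ = z , I ∷ Is , refl

  later-++⁺ : ∀ {R : Rel (Fin n) 0ℓ} {k x y u v ys} (p : Walk R k x y) → Consecutive u v (y ∷ ys) →
              Consecutive u v (x ∷ later p ++ ys)
  later-++⁺ stop       c = c
  later-++⁺ (step r p) c = there (later-++⁺ p c)

  later-++⁻ : ∀ {R : Rel (Fin n) 0ℓ} {k x y u v ys} (p : Walk R k x y) →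
              Consecutive u v (x ∷ later p ++ ys) → (u , v) ∈ steps p ⊎ Consecutive u v (y ∷ ys)
  later-++⁻ stop       c         = inj₂ c
  later-++⁻ (step r p) here      = inj₁ (here refl)
  later-++⁻ (step r p) (there c) = Sum.map₁ there (later-++⁻ p c)

  steps⁻ : ∀ {R : Rel (Fin n) 0ℓ} {k x y u v} ys (p : Walk R k x y) → (u , v) ∈ steps p →
           R u v × Consecutive u v (x ∷ later p ++ ys)
  steps⁻ ys (step r p) (here refl) = r , here
  steps⁻ ys (step r p) (there e)   with r′ , c ← steps⁻ ys p e = r′ , there c

  -- Steps of a negative block are swapped when they become arcs, so every arc points to the larger
  -- vertex whichever way its block is traversed.
  arcs⁻ : ∀ {α x y u v} (bs : Blocks (TT n) α x y) → (u , v) ∈ blocksArcs (TT n) bs →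
          u Fin.< v × Adjacent (x ∷ blocksLater (TT n) bs) u v
  arcs⁻ (_∷_ {a = + _} I Is) e with ∈-++⁻ (steps I) e
  ... | inj₁ e′ with u<v , c ← steps⁻ (blocksLater (TT n) Is) I e′ = u<v , inj₁ c
  ... | inj₂ e′ with u<v , a ← arcs⁻ Is e′ = u<v , Sum.map (later-++⁺ I) (later-++⁺ I) a
  arcs⁻ (_∷_ {a = -[1+ _ ]} I Is) e with ∈-++⁻ (map ×-swap (steps I)) e
  ... | inj₁ e′ with _ , e″ , refl ← ∈-map⁻ ×-swap e′
                with u<v , c ← steps⁻ (blocksLater (TT n) Is) I e″ = u<v , inj₂ c
  ... | inj₂ e′ with u<v , a ← arcs⁻ Is e′ = u<v , Sum.map (later-++⁺ I) (later-++⁺ I) a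

  consecutive⇒arc : ∀ {α x y u v} (bs : Blocks (TT n) α x y) →
                    Consecutive u v (x ∷ blocksLater (TT n) bs) →
                    (u , v) ∈ blocksArcs (TT n) bs ⊎ (v , u) ∈ blocksArcs (TT n) bs
  consecutive⇒arc [] (there ())
  consecutive⇒arc (_∷_ {a = + _} I Is) c with later-++⁻ I c
  ... | inj₁ e  = inj₁ (∈-++⁺ˡ e)
  ... | inj₂ c′ = Sum.map (∈-++⁺ʳ (steps I)) (∈-++⁺ʳ (steps I)) (consecutive⇒arc Is c′)
  consecutive⇒arc (_∷_ {a = -[1+ _ ]} I Is) c with later-++⁻ I c
  ... | inj₁ e  = inj₂ (∈-++⁺ˡ (∈-map⁺ ×-swap e))
  ... | inj₂ c′ = Sum.map (∈-++⁺ʳ (map ×-swap (steps I))) (∈-++⁺ʳ (map ×-swap (steps I)))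
                          (consecutive⇒arc Is c′)

  module _ {α : List ℤ} where
    open OrientedPath
    open Setoid (OrientedPaths (TT n) α) using (_≈_)

    vertices : OrientedPath (TT n) α → List (Fin n)
    vertices P = origin P ∷ blocksLater (TT n) (blocks P)

    adjacent⇒arc : ∀ P {u v} → Adjacent (vertices P) u v → (u , v) ∈ arcs P ⊎ (v , u) ∈ arcs P
    adjacent⇒arc P (inj₁ c) = consecutive⇒arc (blocks P) c
    adjacent⇒arc P (inj₂ c) = Sum.swap (consecutive⇒arc (blocks P) c)

    -- Arcs of both paths point upwards, so a common edge carries the same arc in each.
    ⊑⇒arcs⊆ : ∀ P Q → vertices P ⊑ vertices Q → ∀ {e} → e ∈ arcs P → e ∈ arcs Q
    ⊑⇒arcs⊆ P Q sub e with u<v , a ← arcs⁻ (blocks P) e with adjacent⇒arc Q (sub a)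
    ... | inj₁ e′ = e′
    ... | inj₂ e′ = ⊥-elim (Fin.<-asym u<v (proj₁ (arcs⁻ (blocks Q) e′)))

    arcs⊆⇒⊑ : ∀ P Q → (∀ {e} → e ∈ arcs P → e ∈ arcs Q) → vertices P ⊑ vertices Q
    arcs⊆⇒⊑ P Q sub a with adjacent⇒arc P a
    ... | inj₁ e = proj₂ (arcs⁻ (blocks Q) (sub e))
    ... | inj₂ e = Sum.swap (proj₂ (arcs⁻ (blocks Q) (sub e)))

    ≡⇒≈ : ∀ P Q → vertices P ≡ vertices Q → P ≈ Q
    ≡⇒≈ P Q eq = mk⇔ (⊑⇒arcs⊆ P Q (≡⇒⊑ eq))
                     (⊑⇒arcs⊆ Q P (≡⇒⊑ (sym eq)))

    reverse⇒≈ : ∀ P Q → vertices P ≡ reverse (vertices Q) → P ≈ Q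
    reverse⇒≈ P Q eq =
      mk⇔ (⊑⇒arcs⊆ P Q (λ a → Adjacent-reverse⁻ (≡⇒⊑ eq a)))
          (⊑⇒arcs⊆ Q P (λ a → ≡⇒⊑ (sym eq) (Adjacent-reverse a)))

    -- Paths on one vertex have no arcs to tell them apart, whence the bound on the length.
    ≈⇒≡⊎reverse : ∀ P Q → 2 ≤ length (vertices P) → P ≈ Q →
                  vertices P ≡ vertices Q ⊎ vertices P ≡ reverse (vertices Q)
    ≈⇒≡⊎reverse P Q long P≈Q =
      go (vertices P) long (distinct P) (arcs⊆⇒⊑ P Q (Equivalence.to P≈Q))
                                        (arcs⊆⇒⊑ Q P (Equivalence.from P≈Q))
      where
      go : ∀ xs → 2 ≤ length xs → Unique xs → xs ⊑ vertices Q → vertices Q ⊑ xs →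
           xs ≡ vertices Q ⊎ xs ≡ reverse (vertices Q)
      go (_ ∷ _ ∷ _) _ u sub sup = path-from-edges u (distinct Q) sub sup
      go (_ ∷ []) (s≤s ())

-- Counting paths by representative permutations

module _ {m : ℕ} (α : List ℤ) (‖α‖≡m : ‖ α ‖ ≡ m) where
  open OrientedPath

  private
    T = TT (suc m)

  values : OrientedPath T α → List ℕ
  values P = map toℕ (vertices P)

  values-permutation : ∀ P → IsPermutation m (word α) (values P)
  values-permutation P = record
    { signature = sig
    ; unique    = Unique.map⁺ Fin.toℕ-injective (distinct P)
    ; bounded   = All.map⁺ (All.universal Fin.toℕ≤pred[n] (vertices P))
    ; length≡   = trans (length-Signature sig) (cong suc (trans (length-word α) ‖α‖≡m))
    }
    where sig = blocks⇒signature (blocks P)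

  realise : ∀ {xs} → IsPermutation m (word α) xs → Σ[ P ∈ OrientedPath T α ] values P ≡ xs
  realise {xs} P with fins xs (bounded P)
    where
    fins : ∀ xs → All (_≤ m) xs → ∃[ ys ] map (toℕ {suc m}) ys ≡ xs
    fins []       []       = [] , refl
    fins (x ∷ xs) (b ∷ bs) with ys , eq ← fins xs bs =
      fromℕ< (s≤s b) ∷ ys , cong₂ _∷_ (Fin.toℕ-fromℕ< (s≤s b)) eq
  ... | [] , refl with () ← length≡ P
  ... | y ∷ ys , refl with _ , bs , refl ← signature⇒blocks α (signature P) =
    record { blocks = bs ; distinct = Unique.map⁻ (unique P) } , refl

  -- `reps` selects one vertex sequence per path: `complete` provides at least one of the two
  -- traversals, `oriented` at most one.
  module _ (1≤m : 1 ≤ m) (reps : List (List ℕ)) (reps-unique : Unique reps)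
           (sound : ∀ {xs} → xs ∈ reps → IsPermutation m (word α) xs)
           (complete : ∀ {xs} → IsPermutation m (word α) xs → xs ∈ reps ⊎ reverse xs ∈ reps)
           (oriented : ∀ {xs} → xs ∈ reps → ¬ reverse xs ∈ reps) where
    open Setoid (OrientedPaths T α) using (_≈_) renaming (refl to ≈-refl)

    count-representatives : f[ T ] α ≐ length reps
    count-representatives = record
      { to        = to
      ; cong      = λ { {i} refl → ≈-refl {to i} }
      ; bijective = (λ {i} {j} → injective i j) , surjective
      }
      where
      rep : Fin (length reps) → List ℕ
      rep = lookup reps

      to : Fin (length reps) → OrientedPath T α
      to i = proj₁ (realise (sound (∈-lookup i)))

      values-to : ∀ i → values (to i) ≡ rep i
      values-to i = proj₂ (realise (sound (∈-lookup i)))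

      long : ∀ P → 2 ≤ length (vertices P)
      long P = subst (2 ≤_)
        (sym (trans (sym (length-map toℕ (vertices P))) (length≡ (values-permutation P)))) (s≤s 1≤m)

      injective : ∀ i j → to i ≈ to j → i ≡ j
      injective i j eq with ≈⇒≡⊎reverse (to i) (to j) (long (to i)) eq
      ... | inj₁ eq′ = lookup-injective reps-unique i j
        (trans (sym (values-to i)) (trans (cong (map toℕ) eq′) (values-to j)))
      -- Here `rep i` would be the reverse of `rep j`, against `oriented`.
      ... | inj₂ eq′ = ⊥-elim (oriented (∈-lookup j) (subst (_∈ reps) rep≡ (∈-lookup i)))
        where
        rep≡ : rep i ≡ reverse (rep j)
        rep≡ = trans (sym (values-to i)) (trans (cong (map toℕ) eq′)
                 (trans (reverse-map toℕ (vertices (to j))) (cong reverse (values-to j))))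

      covered : ∀ P → ∃[ i ] to i ≈ P
      covered P with complete (values-permutation P)
      ... | inj₁ p∈ = i , ≡⇒≈ (to i) P (map-injective Fin.toℕ-injective
                            (trans (values-to i) (sym (Any.lookup-index p∈))))
        where i = Any.index p∈
      ... | inj₂ p∈ = i , reverse⇒≈ (to i) P (map-injective Fin.toℕ-injective
                            (trans (values-to i) (trans (sym (Any.lookup-index p∈))
                              (sym (reverse-map toℕ (vertices P))))))
        where i = Any.index p∈

      surjective : ∀ P → ∃[ i ] (∀ {j} → j ≡ i → to j ≈ P)
      surjective P with i , eq ← covered P = i , λ { refl → eq }

-- Choice of a traversal, and the final count

lead : List ℕ → ℕ
lead []      = 0
lead (x ∷ _) = x

lead-++ : ∀ xs {ys} → 1 ≤ length xs → lead (xs ++ ys) ≡ lead xs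
lead-++ (_ ∷ _) _ = refl

lead-∈ : ∀ xs → 1 ≤ length xs → lead xs ∈ xs
lead-∈ (_ ∷ _) _ = here refl

-- Holds for exactly one of the two traversals of a path.
Rising : List ℕ → Set
Rising xs = lead xs < lead (reverse xs)

rising? : ∀ xs → Dec (Rising xs)
rising? xs = lead xs ℕ.<? lead (reverse xs)

rising⇒¬rising-reverse : ∀ xs → Rising xs → ¬ Rising (reverse xs)
rising⇒¬rising-reverse xs p q rewrite reverse-involutive xs = ℕ.<-asym p q

-- The last entry lies in the tail, from which the first is absent, so the two ends are distinct and
-- comparable strictly.
¬rising⇒rising-reverse : ∀ xs → Unique xs → 2 ≤ length xs → ¬ Rising xs → Rising (reverse xs)
¬rising⇒rising-reverse (_ ∷ []) _ (s≤s ())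
¬rising⇒rising-reverse xs@(x ∷ ys@(_ ∷ _)) (x∉ ∷ _) _ ¬p =
  subst (lead (reverse xs) <_) (sym (cong lead (reverse-involutive xs)))
    (ℕ.≤∧≢⇒< (ℕ.≮⇒≥ ¬p) λ eq → All.lookup x∉ last∈ (sym eq))
  where
  1≤ : 1 ≤ length (reverse ys)
  1≤ = subst (1 ≤_) (sym (length-reverse ys)) (s≤s z≤n)
  last∈ : lead (reverse xs) ∈ ys
  last∈ = subst (_∈ ys) (sym (trans (cong lead (unfold-reverse x ys)) (lead-++ (reverse ys) 1≤)))
            (∈-resp-↭ (↭-reverse ys) (lead-∈ (reverse ys) 1≤))

theorem1 : ∀ (n : ℕ) → 2 ≤ n → ∀ (s : ℕ) → 1 ≤ s → ∀ (α : List ℤ) → 𝕂 s α →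
    ‖ α ‖ ≡ n ∸ 1 →
    ∃[ k ] (f[ TT n ] α ≐ k) × (¬ Symmetric α → k ≡ 𝓕 α) × (Symmetric α → 2 * k ≡ 𝓕 α)
theorem1 (suc zero) (s≤s ())
theorem1 (suc (suc m)) _ s _ α κ ‖α‖≡ with _ , A ← 𝕂⇒alternates (𝕂.nonzero κ) (𝕂.alternating κ) =
  go (≡-dec ℤ._≟_ α (map ℤ.-_ (reverse α)))
  where
  L : List (List ℕ)
  L = permutations (suc m) (word α)

  sound : ∀ {xs} → xs ∈ L → IsPermutation (suc m) (word α) xs
  sound = permutations-sound (suc m) (word α)

  complete : ∀ {xs} → IsPermutation (suc m) (word α) xs → xs ∈ L
  complete = permutations-complete (suc m) (word α)

  unique-L : Unique L
  unique-L = permutations-unique (suc m) (word α)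

  length-L : length L ≡ 𝓕 α
  length-L = sym (𝓕-words (λ k w → length (permutations k w)) refl length-permutations m α A ‖α‖≡)

  go : Dec (Symmetric α) →
       ∃[ k ] (f[ TT (suc (suc m)) ] α ≐ k) ×
              (¬ Symmetric α → k ≡ 𝓕 α) × (Symmetric α → 2 * k ≡ 𝓕 α)
  -- All permutations serve as representatives: if a sequence and its reverse both had the word of
  -- `α`, that word would equal its mirror image and `α` would be symmetric.
  go (no ¬sym) = length L
    , count-representatives α ‖α‖≡ (s≤s z≤n) L unique-L sound (inj₁ ∘ complete)
        (λ p q → ¬sym (mirror⇒symmetric A
          (Signature-unique (signature (sound q)) (Signature-reverse (signature (sound p))))))
    , (λ _ → length-L) , λ sym → ⊥-elim (¬sym sym)
  -- Now the enumeration is closed under reversal, and the rising sequences represent each path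
  -- once.
  go (yes sym-α) = length half
    , count-representatives α ‖α‖≡ (s≤s z≤n) half (Unique.filter⁺ rising? unique-L)
        (λ p → sound (proj₁ (∈-filter⁻ rising? p))) half-complete half-oriented
    , (λ ¬sym → ⊥-elim (¬sym sym-α)) , λ _ → trans 2*half length-L
    where
    half : List (List ℕ)
    half = filter rising? L

    reverse-closed : ∀ {xs} → IsPermutation (suc m) (word α) xs →
                     IsPermutation (suc m) (word α) (reverse xs)
    reverse-closed P = subst (λ w → IsPermutation (suc m) w _)
      (sym (trans (cong word sym-α) (word-mirror α))) (IsPermutation-reverse P)

    half-complete : ∀ {xs} → IsPermutation (suc m) (word α) xs → xs ∈ half ⊎ reverse xs ∈ half
    half-complete {xs} P with rising? xs
    ... | yes r = inj₁ (∈-filter⁺ rising? (complete P) r)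
    ... | no ¬r = inj₂ (∈-filter⁺ rising? (complete (reverse-closed P))
      (¬rising⇒rising-reverse xs (unique P) (subst (2 ≤_) (sym (length≡ P)) (s≤s (s≤s z≤n))) ¬r))

    half-oriented : ∀ {xs} → xs ∈ half → ¬ reverse xs ∈ half
    half-oriented {xs} p q = rising⇒¬rising-reverse xs
      (proj₂ (∈-filter⁻ rising? {xs = L} p)) (proj₂ (∈-filter⁻ rising? {xs = L} q))

    -- Reversal carries the rising sequences onto the remaining ones. Both lists are free of
    -- repetitions and have the same members, so they agree up to order.
    L↭ : L ↭ half ++ map reverse half
    L↭ = ∼bag⇒↭ (unique∧set⇒bag unique-L
      (Unique.++⁺ (Unique.filter⁺ rising? unique-L)
        (Unique.map⁺ reverse-injective (Unique.filter⁺ rising? unique-L)) disjoint)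
      (mk⇔ split unsplit))
      where
      disjoint : ∀ {xs} → ¬ (xs ∈ half × xs ∈ map reverse half)
      disjoint (p , q) with ys , ys∈ , refl ← ∈-map⁻ reverse q = half-oriented ys∈ p

      split : ∀ {xs} → xs ∈ L → xs ∈ half ++ map reverse half
      split {xs} p with half-complete (sound p)
      ... | inj₁ q = ∈-++⁺ˡ q
      ... | inj₂ q = ∈-++⁺ʳ half
        (subst (_∈ map reverse half) (reverse-involutive xs) (∈-map⁺ reverse q))

      unsplit : ∀ {xs} → xs ∈ half ++ map reverse half → xs ∈ L
      unsplit p with ∈-++⁻ half p
      ... | inj₁ q = proj₁ (∈-filter⁻ rising? q)
      ... | inj₂ q with ys , ys∈ , refl ← ∈-map⁻ reverse q =
        complete (reverse-closed (sound (proj₁ (∈-filter⁻ rising? ys∈))))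

    2*half : 2 * length half ≡ length L
    2*half = sym (trans (↭-length L↭) (trans (length-++ half)
      (cong (λ k → length half + k) (trans (length-map reverse half) (sym (ℕ.+-identityʳ _))))))
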